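{- Let $d\geq 2$ be an integer. For each $j\in\{0,\ldots,d-1\}$, the sum $$\binom nj+\binom n{j+d}+\binom n{j+2d}+\cdots$$ is asymptotically equal to $2^n/d$ as $n\rightarrow\infty$; that is, $$\lim_{n\rightarrow\infty}\frac{\sum_{i\geq 0}\binom{n}{j+id}}{2^n/d}=1.$$
   Context: $\binom nk$ denotes the binomial coefficient, with $\binom nk=0$ for $k>n$, so the sums are finite. Two sequences are asymptotically equal if their ratio tends to $1$. -}

module Defs where

open import Data.Integer.Base using (+_)
open import Data.List.Base using (map; upTo; applyUpTo)
open import Data.Nat.Base as ℕ using (ℕ; zero; suc; s≤s; z≤n)
open import Data.Nat.Combinatorics using (_C_; k>n⇒nCk≡0)
open import Data.Nat.ListAction using (sum)
import Data.Nat.Properties as ℕ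
open import Data.List.Properties using (map-upTo)
open import Data.Product.Base using (∃-syntax)
open import Data.Rational.Base
open import Data.Rational.Properties using (normalize-pos; pos⇒nonZero)
open import Relation.Binary.PropositionalEquality

-- For a rational limit, quantifying over rational ε is equivalent to
-- quantifying over real ε.
_⟶_ : (ℕ → ℚ) → ℚ → Set
a ⟶ L = ∀ ε → 0ℚ < ε → ∃[ N ] ∀ n → N ℕ.≤ n → ∣ a n - L ∣ < ε

AsymptoticallyEqual : (f g : ℕ → ℚ) → .(∀ n → NonZero (g n)) → Set
AsymptoticallyEqual f g g≢0 = (λ n → (f n ÷ g n) {{g≢0 n}}) ⟶ 1ℚ

-- The first m terms of  n C j + n C (j + d) + n C (j + 2 d) + ⋯
partialBinomialSum : (d j n m : ℕ) → ℕ
partialBinomialSum d j n m = sum (map (λ i → n C (j ℕ.+ i ℕ.* d)) (upTo m))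

-- The full series, for d ≥ 1: its terms with i > n vanish, so it is the sum
-- of the terms i = 0, …, n (see binomialSum-total).
binomialSum : (d j n : ℕ) → ℕ
binomialSum d j n = partialBinomialSum d j n (suc n)

private
  sum-applyUpTo-stable : ∀ (f : ℕ → ℕ) k m → (∀ i → k ℕ.≤ i → f i ≡ 0) →
                         k ℕ.≤ m → sum (applyUpTo f m) ≡ sum (applyUpTo f k)
  sum-applyUpTo-stable f zero zero f≡0 _ = refl
  sum-applyUpTo-stable f zero (suc m) f≡0 _ =
    cong₂ ℕ._+_ (f≡0 0 z≤n)
      (sum-applyUpTo-stable (λ i → f (suc i)) zero m (λ i _ → f≡0 (suc i) z≤n) z≤n)
  sum-applyUpTo-stable f (suc k) (suc m) f≡0 (s≤s k≤m) =
    cong (f 0 ℕ.+_)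
      (sum-applyUpTo-stable (λ i → f (suc i)) k m (λ i k≤i → f≡0 (suc i) (s≤s k≤i)) k≤m)

binomialSum-total : ∀ d .{{_ : ℕ.NonZero d}} j n m → n ℕ.< m →
                    partialBinomialSum d j n m ≡ binomialSum d j n
binomialSum-total d j n m n<m = begin
  sum (map f (upTo m))        ≡⟨ cong sum (map-upTo f m) ⟩
  sum (applyUpTo f m)         ≡⟨ sum-applyUpTo-stable f (suc n) m vanish n<m ⟩
  sum (applyUpTo f (suc n))   ≡⟨ cong sum (map-upTo f (suc n)) ⟨
  sum (map f (upTo (suc n)))  ∎
  where
  open ≡-Reasoning
  f : ℕ → ℕ
  f i = n C (j ℕ.+ i ℕ.* d)
  vanish : ∀ i → n ℕ.< i → f i ≡ 0
  vanish i n<i = k>n⇒nCk≡0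
    (ℕ.≤-trans n<i (ℕ.≤-trans (ℕ.m≤m*n i d) (ℕ.m≤n+m (i ℕ.* d) j)))

2^n/d≢0 : ∀ d .{{_ : ℕ.NonZero d}} n → NonZero (+ (2 ℕ.^ n) / d)
2^n/d≢0 d n = pos⇒nonZero (+ (2 ℕ.^ n) / d) {{normalize-pos (2 ℕ.^ n) d}}
  where instance _ = ℕ.m^n≢0 2 n

{-# OPTIONS --safe #-}

-- Let g(k) = d - 1 if k ≡ j mod d and g(k) = -1 otherwise, so that
-- d · binomialSum d j n - 2^n = Σ (n C k) g(k).  Iterating the map which sends
-- f to f(i) + f(i + 1) n times yields Σ (n C k) f(i + k).  The sum of g over any
-- d consecutive integers vanishes, and the iteration preserves this.  For such
-- an f, subtracting the vanishing sum f(i) + ⋯ + f(i + d - 1) from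
-- Σ ((d-1) C k) f(i + k) shows that d - 1 iterations multiply the supremum norm
-- by at most 2^(d-1) - 1, whereas 2^n is multiplied by 2^(d-1).  The relative
-- error therefore tends to 0 geometrically.

module Submission where

open import Defs
open import Data.Fin.Base using (Fin; toℕ)
open import Data.Fin.Properties using (toℕ<n)
open import Data.Integer.Base as ℤ using (ℤ; +_; +[1+_]; 0ℤ; 1ℤ)
import Data.Integer.Properties as ℤ
import Algebra.Properties.AbelianGroup ℤ.+-0-abelianGroup as ℤGroup
import Data.Integer.Tactic.RingSolver as ℤSolver
open import Data.List.Base using (applyUpTo)
open import Data.List.Properties using (map-upTo)
open import Data.Nat.Base as ℕ using (ℕ; zero; suc; NonZero; _≤_; _<_; _^_; s≤s; z≤n)
open import Data.Nat.Combinatorics using (_C_; nCk+nC[k+1]≡[n+1]C[k+1])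
open import Data.Nat.DivMod using (_%_; /-monoˡ-≤; [m+n]%n≡m%n; m*n/n≡m; m<n⇒m%n≡m; m≡m%n+[m/n]*n)
open import Data.Nat.ListAction using (sum)
import Data.Nat.Properties as ℕ
import Data.Nat.Tactic.RingSolver as ℕSolver
open import Data.Product.Base using (_,_)
open import Data.Rational.Base as ℚ using (_/_; 0ℚ; 1ℚ; _÷_; toℚᵘ; mkℚ)
import Data.Rational.Properties as ℚ
open import Data.Rational.Unnormalised.Base as ℚᵘ using (mkℚᵘ)
import Data.Rational.Unnormalised.Properties as ℚᵘ
open import Function.Base using (_∘_)
open import Relation.Binary.PropositionalEquality

-- Sums over intervals

-- The last argument is the number of terms, not the upper limit.
∑ : (ℕ → ℤ) → ℕ → ℕ → ℤ
∑ f i zero    = 0ℤ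
∑ f i (suc n) = f i ℤ.+ ∑ f (suc i) n

∑-cong< : ∀ {f g} i n → (∀ k → k < i ℕ.+ n → f k ≡ g k) → ∑ f i n ≡ ∑ g i n
∑-cong< i zero    f≡g = refl
∑-cong< i (suc n) f≡g = cong₂ ℤ._+_
  (f≡g i (ℕ.m<m+n i (s≤s z≤n)))
  (∑-cong< (suc i) n (λ k k< → f≡g k (subst (k <_) (sym (ℕ.+-suc i n)) k<)))

∑-cong : ∀ {f g} → (∀ k → f k ≡ g k) → ∀ i n → ∑ f i n ≡ ∑ g i n
∑-cong f≡g i n = ∑-cong< i n (λ k _ → f≡g k)

∑-+ : ∀ f g i n → ∑ (λ k → f k ℤ.+ g k) i n ≡ ∑ f i n ℤ.+ ∑ g i n
∑-+ f g i zero    = refl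
∑-+ f g i (suc n) = trans (cong (ℤ._+_ (f i ℤ.+ g i)) (∑-+ f g (suc i) n))
                          (interchange (f i) (g i) _ _)
  where
  interchange : ∀ a b x y → (a ℤ.+ b) ℤ.+ (x ℤ.+ y) ≡ (a ℤ.+ x) ℤ.+ (b ℤ.+ y)
  interchange = ℤSolver.solve-∀

∑-zero : ∀ i n → ∑ (λ _ → 0ℤ) i n ≡ 0ℤ
∑-zero i zero    = refl
∑-zero i (suc n) = trans (ℤ.+-identityˡ _) (∑-zero (suc i) n)

∑-affine : ∀ a f i n → ∑ (λ k → a ℤ.* f k ℤ.- 1ℤ) i n ≡ a ℤ.* ∑ f i n ℤ.- + n
∑-affine a f i zero    = sym (trans (ℤ.+-identityʳ _) (ℤ.*-zeroʳ a))
∑-affine a f i (suc n) = trans (cong (ℤ._+_ (a ℤ.* f i ℤ.- 1ℤ)) (∑-affine a f (suc i) n))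
                               (lemma a (f i) (∑ f (suc i) n) (+ n))
  where
  lemma : ∀ a x s m → (a ℤ.* x ℤ.- 1ℤ) ℤ.+ (a ℤ.* s ℤ.- m) ≡ a ℤ.* (x ℤ.+ s) ℤ.- (1ℤ ℤ.+ m)
  lemma = ℤSolver.solve-∀

∑-suc : ∀ f i n → ∑ f (suc i) n ≡ ∑ (f ∘ suc) i n
∑-suc f i zero    = refl
∑-suc f i (suc n) = cong (ℤ._+_ (f (suc i))) (∑-suc f (suc i) n)

∑-shift : ∀ f m n → ∑ f m n ≡ ∑ (λ k → f (m ℕ.+ k)) 0 n
∑-shift f zero    n = refl
∑-shift f (suc m) n = trans (∑-suc f m n) (∑-shift (f ∘ suc) m n)

∑-split : ∀ f i m n → ∑ f i (m ℕ.+ n) ≡ ∑ f i m ℤ.+ ∑ f (i ℕ.+ m) n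
∑-split f i zero    n rewrite ℕ.+-identityʳ i = sym (ℤ.+-identityˡ _)
∑-split f i (suc m) n rewrite ℕ.+-suc i m =
  trans (cong (ℤ._+_ (f i)) (∑-split f (suc i) m n)) (sym (ℤ.+-assoc (f i) _ _))

sum-applyUpTo : ∀ f n → + sum (applyUpTo f n) ≡ ∑ (λ i → + f i) 0 n
sum-applyUpTo f zero    = refl
sum-applyUpTo f (suc n) =
  cong (ℤ._+_ (+ f 0)) (trans (sum-applyUpTo (f ∘ suc) n) (sym (∑-suc (λ i → + f i) 0 n)))

-- Iterated sums of neighbours

-- This is (1 + T)^n f at i, where T is the shift operator f ↦ f ∘ `suc`.
walk : (ℕ → ℤ) → ℕ → ℕ → ℤ
walk f zero    i = f i
walk f (suc n) i = walk f n i ℤ.+ walk f n (suc i)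

walk-+ : ∀ f m n i → walk f (m ℕ.+ n) i ≡ walk (walk f n) m i
walk-+ f zero    n i = refl
walk-+ f (suc m) n i = cong₂ ℤ._+_ (walk-+ f m n i) (walk-+ f m n (suc i))

-- The operator is linear, and constants are eigenvectors with eigenvalue 2, so the constant 1
-- becomes 2^n.
walk-affine : ∀ a f n i → walk (λ k → a ℤ.* f k ℤ.- 1ℤ) n i ≡ a ℤ.* walk f n i ℤ.- + (2 ^ n)
walk-affine a f zero    i = refl
walk-affine a f (suc n) i = trans
  (cong₂ ℤ._+_ (walk-affine a f n i) (walk-affine a f n (suc i)))
  (trans (lemma a (walk f n i) (walk f n (suc i)) (+ (2 ^ n)))
         (cong (λ z → a ℤ.* walk f (suc n) i ℤ.- z) (sym (ℤ.pos-* 2 (2 ^ n)))))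
  where
  lemma : ∀ a x y p → (a ℤ.* x ℤ.- p) ℤ.+ (a ℤ.* y ℤ.- p) ≡ a ℤ.* (x ℤ.+ y) ℤ.- + 2 ℤ.* p
  lemma = ℤSolver.solve-∀

-- Pascal's rule, by induction on n. The cutoff `M` is left free because the terms beyond n vanish;
-- this allows a multiple of d to be chosen later.
walk-binomial : ∀ f n i M → n < M →
                walk f n i ≡ ∑ (λ k → + (n C k) ℤ.* f (i ℕ.+ k)) 0 M
walk-binomial f zero i (suc M) _ = sym (begin
  1ℤ ℤ.* f (i ℕ.+ 0) ℤ.+ ∑ h 1 M        ≡⟨ cong₂ ℤ._+_ (ℤ.*-identityˡ (f (i ℕ.+ 0))) (∑-suc h 0 M) ⟩
  f (i ℕ.+ 0) ℤ.+ ∑ (λ _ → 0ℤ) 0 M      ≡⟨ cong₂ ℤ._+_ (cong f (ℕ.+-identityʳ i)) (∑-zero 0 M) ⟩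
  f i ℤ.+ 0ℤ                            ≡⟨ ℤ.+-identityʳ (f i) ⟩
  f i                                   ∎)
  where
  open ≡-Reasoning
  h : ℕ → ℤ
  h k = + (0 C k) ℤ.* f (i ℕ.+ k)
walk-binomial f (suc n) i (suc M) (s≤s n<M) = begin
  walk f n i ℤ.+ walk f n (suc i)
    -- The cutoffs differ by one: once `h 0` is split off, both sums have `M` terms and merge
    -- termwise.
    ≡⟨ cong₂ ℤ._+_ (walk-binomial f n i (suc M) (ℕ.m<n⇒m<1+n n<M)) (walk-binomial f n (suc i) M n<M) ⟩
  (h 0 ℤ.+ ∑ h 1 M) ℤ.+ ∑ h′ 0 M
    ≡⟨ ℤ.+-assoc (h 0) (∑ h 1 M) (∑ h′ 0 M) ⟩
  h 0 ℤ.+ (∑ h 1 M ℤ.+ ∑ h′ 0 M)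
    ≡⟨ cong (λ s → h 0 ℤ.+ (s ℤ.+ ∑ h′ 0 M)) (∑-suc h 0 M) ⟩
  h 0 ℤ.+ (∑ (h ∘ suc) 0 M ℤ.+ ∑ h′ 0 M)
    ≡⟨ cong (ℤ._+_ (h 0)) (∑-+ (h ∘ suc) h′ 0 M) ⟨
  h 0 ℤ.+ ∑ (λ k → h (suc k) ℤ.+ h′ k) 0 M
    ≡⟨ cong (ℤ._+_ (h 0)) (∑-cong pascal 0 M) ⟩
  h 0 ℤ.+ ∑ (H ∘ suc) 0 M
    ≡⟨ cong (ℤ._+_ (h 0)) (∑-suc H 0 M) ⟨
  ∑ H 0 (suc M) ∎
  where
  open ≡-Reasoning
  h h′ H : ℕ → ℤ
  h  k = + (n C k) ℤ.* f (i ℕ.+ k)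
  h′ k = + (n C k) ℤ.* f (suc i ℕ.+ k)
  H  k = + (suc n C k) ℤ.* f (i ℕ.+ k)
  pascal : ∀ k → h (suc k) ℤ.+ h′ k ≡ H (suc k)
  pascal k rewrite ℕ.+-suc i k | sym (nCk+nC[k+1]≡[n+1]C[k+1] n k) =
    trans (sym (ℤ.*-distribʳ-+ x (+ (n C suc k)) (+ (n C k))))
          (cong (λ c → + c ℤ.* x) (ℕ.+-comm (n C suc k) (n C k)))
    where
    x : ℤ
    x = f (suc (i ℕ.+ k))

-- A window of `walk f (suc n)` is the sum of two windows of `walk f n`, one shifted by 1.
∑-walk : ∀ f d → (∀ i → ∑ f i d ≡ 0ℤ) → ∀ n i → ∑ (walk f n) i d ≡ 0ℤ
∑-walk f d ∑≡0 zero    i = ∑≡0 i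
∑-walk f d ∑≡0 (suc n) i = begin
  ∑ (walk f (suc n)) i d                     ≡⟨ ∑-+ (walk f n) (walk f n ∘ suc) i d ⟩
  ∑ (walk f n) i d ℤ.+ ∑ (walk f n ∘ suc) i d ≡⟨ cong₂ ℤ._+_ (∑-walk f d ∑≡0 n i)
                                                 (trans (sym (∑-suc (walk f n) i d)) (∑-walk f d ∑≡0 n (suc i))) ⟩
  0ℤ                                         ∎
  where open ≡-Reasoning

-- Contraction

Bounded : (ℕ → ℤ) → ℕ → Set
Bounded f E = ∀ i → ℤ.∣ f i ∣ ≤ E

module _ {f : ℕ → ℤ} {E : ℕ} (f≤E : Bounded f E) where
  open ℕ.≤-Reasoning

  private
    double : ∀ n → 2 ^ n ℕ.* E ℕ.+ 2 ^ n ℕ.* E ≡ 2 ^ suc n ℕ.* E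
    double n = lemma (2 ^ n) E
      where
      lemma : ∀ x y → x ℕ.* y ℕ.+ x ℕ.* y ≡ 2 ℕ.* x ℕ.* y
      lemma = ℕSolver.solve-∀

  walk-bounded : ∀ n → Bounded (walk f n) (2 ^ n ℕ.* E)
  walk-bounded zero    i = ℕ.≤-trans (f≤E i) (ℕ.m≤m+n E 0)
  walk-bounded (suc n) i = begin
    ℤ.∣ walk f n i ℤ.+ walk f n (suc i) ∣           ≤⟨ ℤ.∣i+j∣≤∣i∣+∣j∣ (walk f n i) _ ⟩
    ℤ.∣ walk f n i ∣ ℕ.+ ℤ.∣ walk f n (suc i) ∣     ≤⟨ ℕ.+-mono-≤ (walk-bounded n i) (walk-bounded n (suc i)) ⟩
    2 ^ n ℕ.* E ℕ.+ 2 ^ n ℕ.* E                     ≡⟨ double n ⟩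
    2 ^ suc n ℕ.* E                                 ∎

  -- The term f i has coefficient n C 0 = 1, so removing it leaves total weight 2^n - 1. Putting `E`
  -- on the left avoids truncated subtraction.
  walk-head-bounded : ∀ n i → ℤ.∣ walk f n i ℤ.- f i ∣ ℕ.+ E ≤ 2 ^ n ℕ.* E
  walk-head-bounded zero i rewrite ℤ.+-inverseʳ (f i) = ℕ.m≤m+n E 0
  walk-head-bounded (suc n) i = begin
    ℤ.∣ (a ℤ.+ b) ℤ.- f i ∣ ℕ.+ E               ≡⟨ cong (λ z → ℤ.∣ z ∣ ℕ.+ E) (rearrange a b (f i)) ⟩
    ℤ.∣ (a ℤ.- f i) ℤ.+ b ∣ ℕ.+ E               ≤⟨ ℕ.+-monoˡ-≤ E (ℤ.∣i+j∣≤∣i∣+∣j∣ (a ℤ.- f i) b) ⟩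
    (ℤ.∣ a ℤ.- f i ∣ ℕ.+ ℤ.∣ b ∣) ℕ.+ E         ≡⟨ swap ℤ.∣ a ℤ.- f i ∣ ℤ.∣ b ∣ E ⟩
    (ℤ.∣ a ℤ.- f i ∣ ℕ.+ E) ℕ.+ ℤ.∣ b ∣         ≤⟨ ℕ.+-mono-≤ (walk-head-bounded n i) (walk-bounded n (suc i)) ⟩
    2 ^ n ℕ.* E ℕ.+ 2 ^ n ℕ.* E                 ≡⟨ double n ⟩
    2 ^ suc n ℕ.* E                             ∎
    where
    a b : ℤ
    a = walk f n i
    b = walk f n (suc i)
    rearrange : ∀ a b x → (a ℤ.+ b) ℤ.- x ≡ (a ℤ.- x) ℤ.+ b
    rearrange = ℤSolver.solve-∀
    swap : ∀ x y z → (x ℕ.+ y) ℕ.+ z ≡ (x ℕ.+ z) ℕ.+ y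
    swap = ℕSolver.solve-∀

  -- All n + 1 binomial coefficients in walk f n i = Σ (n C k) f (i + k) are
  -- positive, so subtracting f i + ⋯ + f (i + n) leaves total weight 2^n - n - 1.
  walk-window-bounded : ∀ n i →
    ℤ.∣ walk f n i ℤ.- ∑ f i (suc n) ∣ ℕ.+ suc n ℕ.* E ≤ 2 ^ n ℕ.* E
  walk-window-bounded zero i
    rewrite ℤ.+-identityʳ (f i) | ℤ.+-inverseʳ (f i) = ℕ.≤-refl
  walk-window-bounded (suc n) i = begin
    ℤ.∣ (a ℤ.+ b) ℤ.- (f i ℤ.+ w) ∣ ℕ.+ (E ℕ.+ suc n ℕ.* E)
      ≡⟨ cong (λ z → ℤ.∣ z ∣ ℕ.+ (E ℕ.+ suc n ℕ.* E)) (rearrange a b (f i) w) ⟩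
    ℤ.∣ (a ℤ.- f i) ℤ.+ (b ℤ.- w) ∣ ℕ.+ (E ℕ.+ suc n ℕ.* E)
      ≤⟨ ℕ.+-monoˡ-≤ (E ℕ.+ suc n ℕ.* E) (ℤ.∣i+j∣≤∣i∣+∣j∣ (a ℤ.- f i) (b ℤ.- w)) ⟩
    (ℤ.∣ a ℤ.- f i ∣ ℕ.+ ℤ.∣ b ℤ.- w ∣) ℕ.+ (E ℕ.+ suc n ℕ.* E)
      ≡⟨ interchange ℤ.∣ a ℤ.- f i ∣ ℤ.∣ b ℤ.- w ∣ E (suc n ℕ.* E) ⟩
    (ℤ.∣ a ℤ.- f i ∣ ℕ.+ E) ℕ.+ (ℤ.∣ b ℤ.- w ∣ ℕ.+ suc n ℕ.* E)
      ≤⟨ ℕ.+-mono-≤ (walk-head-bounded n i) (walk-window-bounded n (suc i)) ⟩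
    2 ^ n ℕ.* E ℕ.+ 2 ^ n ℕ.* E
      ≡⟨ double n ⟩
    2 ^ suc n ℕ.* E ∎
    where
    a b w : ℤ
    a = walk f n i
    b = walk f n (suc i)
    w = ∑ f (suc i) (suc n)
    rearrange : ∀ a b x y → (a ℤ.+ b) ℤ.- (x ℤ.+ y) ≡ (a ℤ.- x) ℤ.+ (b ℤ.- y)
    rearrange = ℤSolver.solve-∀
    interchange : ∀ x y z t → (x ℕ.+ y) ℕ.+ (z ℕ.+ t) ≡ (x ℕ.+ z) ℕ.+ (y ℕ.+ t)
    interchange = ℕSolver.solve-∀

  -- The window has q + 1 = d terms and sum zero, so subtracting it changes nothing in `walk f q i`
  -- but lowers the total weight of the coefficients.
  walk-contracts : ∀ q c → 2 ^ q ≡ suc c → (∀ i → ∑ f i (suc q) ≡ 0ℤ) →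
                   Bounded (walk f q) (c ℕ.* E)
  walk-contracts q c 2^q≡1+c ∑≡0 i = ℕ.+-cancelˡ-≤ E _ _ (begin
    -- Only one of the q + 1 saved multiples of `E` is kept: a factor c = 2^q - 1 against 2^q
    -- already gives geometric decay.
    E ℕ.+ ℤ.∣ walk f q i ∣                             ≤⟨ ℕ.+-monoˡ-≤ _ (ℕ.m≤m+n E (q ℕ.* E)) ⟩
    suc q ℕ.* E ℕ.+ ℤ.∣ walk f q i ∣                   ≡⟨ ℕ.+-comm (suc q ℕ.* E) _ ⟩
    ℤ.∣ walk f q i ∣ ℕ.+ suc q ℕ.* E                   ≡⟨ cong (λ z → ℤ.∣ z ∣ ℕ.+ suc q ℕ.* E) (ℤ.+-identityʳ (walk f q i)) ⟨
    ℤ.∣ walk f q i ℤ.- 0ℤ ∣ ℕ.+ suc q ℕ.* E            ≡⟨ cong (λ z → ℤ.∣ walk f q i ℤ.- z ∣ ℕ.+ suc q ℕ.* E) (∑≡0 i) ⟨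
    ℤ.∣ walk f q i ℤ.- ∑ f i (suc q) ∣ ℕ.+ suc q ℕ.* E ≤⟨ walk-window-bounded q i ⟩
    2 ^ q ℕ.* E                                        ≡⟨ cong (ℕ._* E) 2^q≡1+c ⟩
    E ℕ.+ c ℕ.* E                                      ∎)

-- (1 + 1/c)^t ≥ 1 + t/c with denominators cleared.
bernoulli : ∀ c t → c ^ t ℕ.* (c ℕ.+ t) ≤ c ℕ.* suc c ^ t
bernoulli c zero    = ℕ.≤-reflexive (lemma c)
  where
  lemma : ∀ c → 1 ℕ.* (c ℕ.+ 0) ≡ c ℕ.* 1
  lemma = ℕSolver.solve-∀
bernoulli c (suc t) = begin
  c ℕ.* c ^ t ℕ.* (c ℕ.+ suc t)                ≤⟨ ℕ.m≤m+n _ (c ^ t ℕ.* t) ⟩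
  c ℕ.* c ^ t ℕ.* (c ℕ.+ suc t) ℕ.+ c ^ t ℕ.* t ≡⟨ lemma₁ c (c ^ t) t ⟩
  suc c ℕ.* (c ^ t ℕ.* (c ℕ.+ t))              ≤⟨ ℕ.*-monoʳ-≤ (suc c) (bernoulli c t) ⟩
  suc c ℕ.* (c ℕ.* suc c ^ t)                  ≡⟨ lemma₂ c (suc c ^ t) ⟩
  c ℕ.* (suc c ℕ.* suc c ^ t)                  ∎
  where
  open ℕ.≤-Reasoning
  lemma₁ : ∀ c x t → c ℕ.* x ℕ.* (c ℕ.+ suc t) ℕ.+ x ℕ.* t ≡ suc c ℕ.* (x ℕ.* (c ℕ.+ t))
  lemma₁ = ℕSolver.solve-∀
  lemma₂ : ∀ c x → suc c ℕ.* (c ℕ.* x) ≡ c ℕ.* (suc c ℕ.* x)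
  lemma₂ = ℕSolver.solve-∀

module _ (f : ℕ → ℤ) (E q c : ℕ) (f≤E : Bounded f E) (2^q≡1+c : 2 ^ q ≡ suc c)
         (∑≡0 : ∀ i → ∑ f i (suc q) ≡ 0ℤ) where

  -- Each block of q steps contracts again, since the windows of `walk f (t ℕ.* q)` still sum to
  -- zero.
  walk-geometric : ∀ t → Bounded (walk f (t ℕ.* q)) (c ^ t ℕ.* E)
  walk-geometric zero    i = ℕ.≤-trans (f≤E i) (ℕ.m≤m+n E 0)
  walk-geometric (suc t) i = begin
    ℤ.∣ walk f (q ℕ.+ t ℕ.* q) i ∣     ≡⟨ cong ℤ.∣_∣ (walk-+ f q (t ℕ.* q) i) ⟩
    ℤ.∣ walk (walk f (t ℕ.* q)) q i ∣  ≤⟨ walk-contracts (walk-geometric t) q c 2^q≡1+c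
                                            (∑-walk f (suc q) ∑≡0 (t ℕ.* q)) i ⟩
    c ℕ.* (c ^ t ℕ.* E)                ≡⟨ ℕ.*-assoc c (c ^ t) E ⟨
    c ^ suc t ℕ.* E                    ∎
    where open ℕ.≤-Reasoning

  -- The r leftover steps cost at most 2^r, and Bernoulli's inequality weakens (c/(c+1))^t to
  -- c/(c+t). After n = r + tq steps the error relative to 2^n is thus at most cE/(c+t), which makes
  -- an explicit threshold easy to state.
  walk-decay : ∀ r t i →
    ℤ.∣ walk f (r ℕ.+ t ℕ.* q) i ∣ ℕ.* (c ℕ.+ t) ≤ c ℕ.* E ℕ.* 2 ^ (r ℕ.+ t ℕ.* q)
  walk-decay r t i = begin
    ℤ.∣ walk f (r ℕ.+ t ℕ.* q) i ∣ ℕ.* (c ℕ.+ t)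
      ≡⟨ cong (λ z → ℤ.∣ z ∣ ℕ.* (c ℕ.+ t)) (walk-+ f r (t ℕ.* q) i) ⟩
    ℤ.∣ walk (walk f (t ℕ.* q)) r i ∣ ℕ.* (c ℕ.+ t)
      ≤⟨ ℕ.*-monoˡ-≤ (c ℕ.+ t) (walk-bounded (walk-geometric t) r i) ⟩
    2 ^ r ℕ.* (c ^ t ℕ.* E) ℕ.* (c ℕ.+ t)
      ≡⟨ lemma₁ (2 ^ r) (c ^ t) E (c ℕ.+ t) ⟩
    2 ^ r ℕ.* E ℕ.* (c ^ t ℕ.* (c ℕ.+ t))
      ≤⟨ ℕ.*-monoʳ-≤ (2 ^ r ℕ.* E) (bernoulli c t) ⟩
    2 ^ r ℕ.* E ℕ.* (c ℕ.* suc c ^ t)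
      ≡⟨ lemma₂ (2 ^ r) E c (suc c ^ t) ⟩
    c ℕ.* E ℕ.* (2 ^ r ℕ.* suc c ^ t)
      ≡⟨ cong (λ z → c ℕ.* E ℕ.* (2 ^ r ℕ.* z)) power ⟩
    c ℕ.* E ℕ.* (2 ^ r ℕ.* 2 ^ (t ℕ.* q))
      ≡⟨ cong (c ℕ.* E ℕ.*_) (ℕ.^-distribˡ-+-* 2 r (t ℕ.* q)) ⟨
    c ℕ.* E ℕ.* 2 ^ (r ℕ.+ t ℕ.* q) ∎
    where
    open ℕ.≤-Reasoning
    lemma₁ : ∀ x y z w → x ℕ.* (y ℕ.* z) ℕ.* w ≡ x ℕ.* z ℕ.* (y ℕ.* w)
    lemma₁ = ℕSolver.solve-∀
    lemma₂ : ∀ x y z w → x ℕ.* y ℕ.* (z ℕ.* w) ≡ z ℕ.* y ℕ.* (x ℕ.* w)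
    lemma₂ = ℕSolver.solve-∀
    power : suc c ^ t ≡ 2 ^ (t ℕ.* q)
    power = trans (cong (_^ t) (sym 2^q≡1+c))
                  (trans (ℕ.^-*-assoc 2 q t) (cong (2 ^_) (ℕ.*-comm q t)))

-- Residue classes

δ : ℕ → ℕ → ℤ
δ zero    zero    = 1ℤ
δ zero    (suc k) = 0ℤ
δ (suc j) zero    = 0ℤ
δ (suc j) (suc k) = δ j k

∣δ∣≤1 : ∀ j k → ℤ.∣ δ j k ∣ ≤ 1
∣δ∣≤1 zero    zero    = s≤s z≤n
∣δ∣≤1 zero    (suc k) = z≤n
∣δ∣≤1 (suc j) zero    = z≤n
∣δ∣≤1 (suc j) (suc k) = ∣δ∣≤1 j k

∑-δ : ∀ w j n → j < n → ∑ (λ k → w k ℤ.* δ j k) 0 n ≡ w j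
∑-δ w zero (suc n) _ = begin
  w 0 ℤ.* 1ℤ ℤ.+ ∑ (λ k → w k ℤ.* δ 0 k) 1 n  ≡⟨ cong₂ ℤ._+_ (ℤ.*-identityʳ (w 0)) (∑-suc _ 0 n) ⟩
  w 0 ℤ.+ ∑ (λ k → w (suc k) ℤ.* 0ℤ) 0 n      ≡⟨ cong (ℤ._+_ (w 0)) (∑-cong (λ k → ℤ.*-zeroʳ (w (suc k))) 0 n) ⟩
  w 0 ℤ.+ ∑ (λ _ → 0ℤ) 0 n                    ≡⟨ cong (ℤ._+_ (w 0)) (∑-zero 0 n) ⟩
  w 0 ℤ.+ 0ℤ                                  ≡⟨ ℤ.+-identityʳ (w 0) ⟩
  w 0                                         ∎
  where open ≡-Reasoning
∑-δ w (suc j) (suc n) (s≤s j<n) = begin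
  w 0 ℤ.* 0ℤ ℤ.+ ∑ (λ k → w k ℤ.* δ (suc j) k) 1 n  ≡⟨ cong₂ ℤ._+_ (ℤ.*-zeroʳ (w 0)) (∑-suc _ 0 n) ⟩
  0ℤ ℤ.+ ∑ (λ k → w (suc k) ℤ.* δ j k) 0 n          ≡⟨ ℤ.+-identityˡ _ ⟩
  ∑ (λ k → w (suc k) ℤ.* δ j k) 0 n                 ≡⟨ ∑-δ (w ∘ suc) j n j<n ⟩
  w (suc j)                                         ∎
  where open ≡-Reasoning

module _ (d : ℕ) .{{_ : NonZero d}} (j : ℕ) (j<d : j < d) where
  open ≡-Reasoning

  inClass : ℕ → ℤ
  inClass k = δ j (k % d)

  inClass-periodic : ∀ k → inClass (d ℕ.+ k) ≡ inClass k
  inClass-periodic k = cong (δ j) (trans (cong (_% d) (ℕ.+-comm d k)) ([m+n]%n≡m%n k d))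

  ∑-inClass-block : ∀ w → ∑ (λ k → w k ℤ.* inClass k) 0 d ≡ w j
  ∑-inClass-block w = trans
    (∑-cong< 0 d (λ k k<d → cong (λ r → w k ℤ.* δ j r) (m<n⇒m%n≡m k<d)))
    (∑-δ w j d j<d)

  -- Each block of d indices contributes its single member of the class. The weight `w` is arbitrary
  -- so that the induction can shift it by d.
  ∑-inClass : ∀ w m → ∑ (λ k → w k ℤ.* inClass k) 0 (m ℕ.* d) ≡ ∑ (λ i → w (j ℕ.+ i ℕ.* d)) 0 m
  ∑-inClass w zero    = refl
  ∑-inClass w (suc m) = begin
    ∑ h 0 (d ℕ.+ m ℕ.* d)                            ≡⟨ ∑-split h 0 d (m ℕ.* d) ⟩
    ∑ h 0 d ℤ.+ ∑ h d (m ℕ.* d)                      ≡⟨ cong₂ ℤ._+_ (∑-inClass-block w) (∑-shift h d (m ℕ.* d)) ⟩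
    w j ℤ.+ ∑ (λ k → h (d ℕ.+ k)) 0 (m ℕ.* d)        ≡⟨ cong (ℤ._+_ (w j)) (∑-cong (λ k → cong (w (d ℕ.+ k) ℤ.*_) (inClass-periodic k)) 0 (m ℕ.* d)) ⟩
    w j ℤ.+ ∑ (λ k → w (d ℕ.+ k) ℤ.* inClass k) 0 (m ℕ.* d)
                                                     ≡⟨ cong (ℤ._+_ (w j)) (∑-inClass (λ k → w (d ℕ.+ k)) m) ⟩
    w j ℤ.+ ∑ (λ i → w (d ℕ.+ (j ℕ.+ i ℕ.* d))) 0 m  ≡⟨ cong₂ ℤ._+_ (cong w (sym (ℕ.+-identityʳ j)))
                                                          (∑-cong (λ i → cong w (swap d j (i ℕ.* d))) 0 m) ⟩
    v 0 ℤ.+ ∑ (v ∘ suc) 0 m                          ≡⟨ cong (ℤ._+_ (v 0)) (∑-suc v 0 m) ⟨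
    ∑ v 0 (suc m)                                    ∎
    where
    h v : ℕ → ℤ
    h k = w k ℤ.* inClass k
    v i = w (j ℕ.+ i ℕ.* d)
    swap : ∀ x y z → x ℕ.+ (y ℕ.+ z) ≡ y ℕ.+ (x ℕ.+ z)
    swap = ℕSolver.solve-∀

  -- Sliding the window by one drops `inClass i` and gains `inClass (i ℕ.+ d)`, which is equal by
  -- periodicity.
  ∑-inClass-window : ∀ i → ∑ inClass i d ≡ 1ℤ
  ∑-inClass-window zero    = trans
    (∑-cong (λ k → sym (ℤ.*-identityˡ (inClass k))) 0 d) (∑-inClass-block (λ _ → 1ℤ))
  ∑-inClass-window (suc i) = ℤGroup.∙-cancelʳ (inClass i) _ _ (begin
    ∑ inClass (suc i) d ℤ.+ inClass i                ≡⟨ ℤ.+-comm _ (inClass i) ⟩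
    ∑ inClass i (1 ℕ.+ d)                            ≡⟨ cong (∑ inClass i) (ℕ.+-comm 1 d) ⟩
    ∑ inClass i (d ℕ.+ 1)                            ≡⟨ ∑-split inClass i d 1 ⟩
    ∑ inClass i d ℤ.+ (inClass (i ℕ.+ d) ℤ.+ 0ℤ)     ≡⟨ cong₂ ℤ._+_ (∑-inClass-window i) (ℤ.+-identityʳ (inClass (i ℕ.+ d))) ⟩
    1ℤ ℤ.+ inClass (i ℕ.+ d)                         ≡⟨ cong (λ k → 1ℤ ℤ.+ inClass k) (ℕ.+-comm i d) ⟩
    1ℤ ℤ.+ inClass (d ℕ.+ i)                         ≡⟨ cong (ℤ._+_ 1ℤ) (inClass-periodic i) ⟩
    1ℤ ℤ.+ inClass i                                 ∎)

  walk-inClass : ∀ n → walk inClass n 0 ≡ + binomialSum d j n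
  walk-inClass n = begin
    -- The cutoff (n + 1)d exceeds n and consists of n + 1 full blocks, one for each term of
    -- `binomialSum d j n`.
    walk inClass n 0                                    ≡⟨ walk-binomial inClass n 0 (suc n ℕ.* d) (ℕ.m≤m*n (suc n) d) ⟩
    ∑ (λ k → + (n C k) ℤ.* inClass k) 0 (suc n ℕ.* d)   ≡⟨ ∑-inClass (λ k → + (n C k)) (suc n) ⟩
    ∑ (λ i → + (n C (j ℕ.+ i ℕ.* d))) 0 (suc n)         ≡⟨ sum-applyUpTo term (suc n) ⟨
    + sum (applyUpTo term (suc n))                      ≡⟨ cong (λ l → + sum l) (map-upTo term (suc n)) ⟨
    + binomialSum d j n                                 ∎
    where
    term : ℕ → ℕ
    term i = n C (j ℕ.+ i ℕ.* d)

  -- The function g of the overview, with values d - 1 and -1.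
  deviation : ℕ → ℤ
  deviation k = + d ℤ.* inClass k ℤ.- 1ℤ

  ∑-deviation : ∀ i → ∑ deviation i d ≡ 0ℤ
  ∑-deviation i = begin
    ∑ deviation i d                     ≡⟨ ∑-affine (+ d) inClass i d ⟩
    + d ℤ.* ∑ inClass i d ℤ.- + d       ≡⟨ cong (λ s → + d ℤ.* s ℤ.- + d) (∑-inClass-window i) ⟩
    + d ℤ.* 1ℤ ℤ.- + d                  ≡⟨ cong (ℤ._- + d) (ℤ.*-identityʳ (+ d)) ⟩
    + d ℤ.- + d                         ≡⟨ ℤ.+-inverseʳ (+ d) ⟩
    0ℤ                                  ∎

  -- The triangle inequality gives d + 1; the sharp value d - 1 would improve only the constant in
  -- the rate.
  deviation-bounded : Bounded deviation (suc d)
  deviation-bounded k = ≤R.begin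
    ℤ.∣ + d ℤ.* inClass k ℤ.- 1ℤ ∣      ≤R.≤⟨ ℤ.∣i-j∣≤∣i∣+∣j∣ (+ d ℤ.* inClass k) 1ℤ ⟩
    ℤ.∣ + d ℤ.* inClass k ∣ ℕ.+ 1       ≤R.≡⟨ cong (ℕ._+ 1) (ℤ.abs-* (+ d) (inClass k)) ⟩
    d ℕ.* ℤ.∣ inClass k ∣ ℕ.+ 1         ≤R.≤⟨ ℕ.+-monoˡ-≤ 1 (ℕ.*-monoʳ-≤ d (∣δ∣≤1 j (k % d))) ⟩
    d ℕ.* 1 ℕ.+ 1                       ≤R.≡⟨ cong (ℕ._+ 1) (ℕ.*-identityʳ d) ⟩
    d ℕ.+ 1                             ≤R.≡⟨ ℕ.+-comm d 1 ⟩
    suc d                               ≤R.∎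
    where module ≤R = ℕ.≤-Reasoning

  walk-deviation : ∀ n → walk deviation n 0 ≡ + d ℤ.* + binomialSum d j n ℤ.- + (2 ^ n)
  walk-deviation n = trans (walk-affine (+ d) inClass n 0)
    (cong (λ s → + d ℤ.* s ℤ.- + (2 ^ n)) (walk-inClass n))

-- The rational limit

p≡r*q⇒p÷q≡r : ∀ p q r .{{_ : ℚ.NonZero q}} → p ≡ r ℚ.* q → p ÷ q ≡ r
p≡r*q⇒p÷q≡r p q r p≡rq = begin
  p ℚ.* ℚ.1/ q            ≡⟨ cong (ℚ._* ℚ.1/ q) p≡rq ⟩
  r ℚ.* q ℚ.* ℚ.1/ q      ≡⟨ ℚ.*-assoc r q (ℚ.1/ q) ⟩
  r ℚ.* (q ℚ.* ℚ.1/ q)    ≡⟨ cong (r ℚ.*_) (ℚ.*-inverseʳ q) ⟩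
  r ℚ.* 1ℚ                ≡⟨ ℚ.*-identityʳ r ⟩
  r                       ∎
  where open ≡-Reasoning

toℚᵘ-/ : ∀ n d .{{_ : NonZero d}} → toℚᵘ (n / d) ℚᵘ.≃ n ℚᵘ./ d
toℚᵘ-/ n (suc d) = ℚ.toℚᵘ-fromℚᵘ (mkℚᵘ n d)

-- The quotient is checked by multiplying back, and the product is compared in the unnormalised
-- rationals, where equality is cross multiplication.
÷-fraction : ∀ s p d .{{_ : NonZero p}} .{{_ : NonZero d}} .{{nz : ℚ.NonZero (+ p / d)}} →
             (s / 1) ÷ (+ p / d) ≡ (+ d ℤ.* s) / p
÷-fraction s p@(suc _) d@(suc _) = p≡r*q⇒p÷q≡r (s / 1) (+ p / d) ((+ d ℤ.* s) / p) (ℚ.toℚᵘ-injective (begin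
  toℚᵘ (s / 1)                                       ≈⟨ toℚᵘ-/ s 1 ⟩
  s ℚᵘ./ 1                                           ≈⟨ ℚᵘ.*≡* (lemma s (+ p) (+ d)) ⟩
  ((+ d ℤ.* s) ℚᵘ./ p) ℚᵘ.* (+ p ℚᵘ./ d)             ≈⟨ ℚᵘ.*-cong (toℚᵘ-/ (+ d ℤ.* s) p) (toℚᵘ-/ (+ p) d) ⟨
  toℚᵘ ((+ d ℤ.* s) / p) ℚᵘ.* toℚᵘ (+ p / d)         ≈⟨ ℚ.toℚᵘ-homo-* ((+ d ℤ.* s) / p) (+ p / d) ⟨
  toℚᵘ (((+ d ℤ.* s) / p) ℚ.* (+ p / d))             ∎))
  where
  open import Relation.Binary.Reasoning.Setoid ℚᵘ.≃-setoid
  lemma : ∀ s p d → s ℤ.* (p ℤ.* d) ≡ d ℤ.* s ℤ.* p ℤ.* 1ℤ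
  lemma = ℤSolver.solve-∀

-- A positive ε has numerator at least 1, so it suffices to bring |a - p|/p below the reciprocal of
-- its denominator.
∣fraction-1∣<ε : ∀ a p .{{_ : NonZero p}} ε → 0ℚ ℚ.< ε →
                 ℤ.∣ a ℤ.- + p ∣ ℕ.* ℚ.↧ₙ ε < p → ℚ.∣ a / p ℚ.- 1ℚ ∣ ℚ.< ε
∣fraction-1∣<ε a p@(suc _) ε@(mkℚ (+ zero) _ _) (ℚ.*<* (ℤ.+<+ ())) _
∣fraction-1∣<ε a p@(suc _) ε@(mkℚ +[1+ m ] b _) _ small = ℚ.toℚᵘ-cancel-< (begin-strict
  toℚᵘ ℚ.∣ a / p ℚ.- 1ℚ ∣                 ≃⟨ ℚ.toℚᵘ-homo-∣-∣ (a / p ℚ.- 1ℚ) ⟩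
  ℚᵘ.∣ toℚᵘ (a / p ℚ.- 1ℚ) ∣              ≃⟨ ℚᵘ.∣-∣-cong (ℚ.toℚᵘ-homo-+ (a / p) (ℚ.- 1ℚ)) ⟩
  ℚᵘ.∣ toℚᵘ (a / p) ℚᵘ.- ℚᵘ.1ℚᵘ ∣         ≃⟨ ℚᵘ.∣-∣-cong (ℚᵘ.+-congˡ (ℚᵘ.- ℚᵘ.1ℚᵘ) (toℚᵘ-/ a p)) ⟩
  ℚᵘ.∣ a ℚᵘ./ p ℚᵘ.- ℚᵘ.1ℚᵘ ∣             ≃⟨ ℚᵘ.∣-∣-cong {a ℚᵘ./ p ℚᵘ.- ℚᵘ.1ℚᵘ} {(a ℤ.- + p) ℚᵘ./ p} (ℚᵘ.*≡* (lemma a (+ p))) ⟩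
  ℚᵘ.∣ (a ℤ.- + p) ℚᵘ./ p ∣               <⟨ ℚᵘ.*<* (subst₂ ℤ._<_
                                               (ℤ.pos-* ℤ.∣ a ℤ.- + p ∣ (suc b)) (ℤ.pos-* (suc m) p)
                                               (ℤ.+<+ (ℕ.<-≤-trans small (ℕ.m≤n*m p (suc m))))) ⟩
  toℚᵘ ε                                  ∎)
  where
  open ℚᵘ.≤-Reasoning
  lemma : ∀ a p → (a ℤ.* 1ℤ ℤ.+ ℤ.- 1ℤ ℤ.* p) ℤ.* p ≡ (a ℤ.- p) ℤ.* (p ℤ.* 1ℤ)
  lemma = ℤSolver.solve-∀

mainTheorem2 : ∀ (d : ℕ) .{{_ : NonZero d}} → 2 ≤ d → (j : Fin d) →
    AsymptoticallyEqual
    (λ n → + binomialSum d (toℕ j) n / 1)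
    (λ n → + (2 ^ n) / d)
    (2^n/d≢0 d)
-- Here q = d - 1, and d ≥ 2 makes it nonzero, so that n can be divided by q.
mainTheorem2 d@(suc q@(suc _)) (s≤s (s≤s _)) j ε 0<ε = N , close
  where
  c K N : ℕ
  c = ℕ.pred (2 ^ q)
  -- The constant of `walk-decay` with E = d + 1, times the denominator of ε. For n ≥ N there are at
  -- least K + 1 full blocks of q steps.
  K = c ℕ.* suc d ℕ.* ℚ.↧ₙ ε
  N = suc K ℕ.* q
  S : ℕ → ℕ
  S = binomialSum d (toℕ j)
  x : ℕ → ℤ
  x n = + d ℤ.* + S n ℤ.- + (2 ^ n)

  decay : ∀ n → ℤ.∣ x n ∣ ℕ.* (c ℕ.+ n ℕ./ q) ≤ c ℕ.* suc d ℕ.* 2 ^ n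
  -- The bound is applied with r = n % q and t = n / q, then transported along `n≡`.
  decay n = subst₂ (λ y m → ℤ.∣ y ∣ ℕ.* (c ℕ.+ n ℕ./ q) ≤ c ℕ.* suc d ℕ.* 2 ^ m)
    (trans (cong (λ m → walk g m 0) (sym n≡)) (walk-deviation d (toℕ j) (toℕ<n j) n)) (sym n≡)
    (walk-decay g (suc d) q c (deviation-bounded d (toℕ j) (toℕ<n j))
      (sym (ℕ.suc-pred (2 ^ q) {{ℕ.m^n≢0 2 q}})) (∑-deviation d (toℕ j) (toℕ<n j)) (n % q) (n ℕ./ q) 0)
    where
    g : ℕ → ℤ
    g = deviation d (toℕ j) (toℕ<n j)
    n≡ : n ≡ n % q ℕ.+ (n ℕ./ q) ℕ.* q
    n≡ = m≡m%n+[m/n]*n n q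

  small : ∀ n → N ≤ n → ℤ.∣ x n ∣ ℕ.* ℚ.↧ₙ ε < 2 ^ n
  small n N≤n = ℕ.*-cancelˡ-< (suc K) _ _ (begin-strict
    suc K ℕ.* (ℤ.∣ x n ∣ ℕ.* b)            ≡⟨ lemma₁ (suc K) ℤ.∣ x n ∣ b ⟩
    ℤ.∣ x n ∣ ℕ.* suc K ℕ.* b              ≤⟨ ℕ.*-monoˡ-≤ b (ℕ.*-monoʳ-≤ ℤ.∣ x n ∣ K<) ⟩
    ℤ.∣ x n ∣ ℕ.* (c ℕ.+ n ℕ./ q) ℕ.* b    ≤⟨ ℕ.*-monoˡ-≤ b (decay n) ⟩
    c ℕ.* suc d ℕ.* 2 ^ n ℕ.* b            ≡⟨ lemma₂ (c ℕ.* suc d) (2 ^ n) b ⟩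
    -- Strictness comes from here: the number of blocks exceeds K by at least one, and 2^n is
    -- positive.
    K ℕ.* 2 ^ n                            <⟨ ℕ.*-monoˡ-< (2 ^ n) {{ℕ.m^n≢0 2 n}} (ℕ.n<1+n K) ⟩
    suc K ℕ.* 2 ^ n                        ∎)
    where
    open ℕ.≤-Reasoning
    b : ℕ
    b = ℚ.↧ₙ ε
    K< : suc K ≤ c ℕ.+ n ℕ./ q
    K< = ℕ.≤-trans
      (subst (_≤ n ℕ./ q) (m*n/n≡m (suc K) q) (/-monoˡ-≤ q N≤n)) (ℕ.m≤n+m (n ℕ./ q) c)
    lemma₁ : ∀ k y b → k ℕ.* (y ℕ.* b) ≡ y ℕ.* k ℕ.* b
    lemma₁ = ℕSolver.solve-∀
    lemma₂ : ∀ k y b → k ℕ.* y ℕ.* b ≡ k ℕ.* b ℕ.* y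
    lemma₂ = ℕSolver.solve-∀

  close : ∀ n → N ≤ n → ℚ.∣ ((+ S n / 1) ÷ (+ (2 ^ n) / d)) {{2^n/d≢0 d n}} ℚ.- 1ℚ ∣ ℚ.< ε
  close n N≤n = subst (λ y → ℚ.∣ y ℚ.- 1ℚ ∣ ℚ.< ε)
    (sym (÷-fraction (+ S n) (2 ^ n) d {{ℕ.m^n≢0 2 n}} {{nz = 2^n/d≢0 d n}}))
    (∣fraction-1∣<ε (+ d ℤ.* + S n) (2 ^ n) {{ℕ.m^n≢0 2 n}} ε 0<ε (small n N≤n))
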